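{- Let $T\subseteq \mathrm{Trc}=\mathbb{D}^\omega$ be a set of traces that is stable under renamings, i.e. $\sigma(T)=T$ for every bijection $\sigma:\mathbb{D}\to\mathbb{D}$ (applied letterwise to traces). Then $T$ is completely monitorable if and only if there is a closed formula $\varphi\in\mathrm{HML}^d$ with $[\![\varphi]\!]=T$.
   Context: **Data and traces.** Fix a countably infinite set $\mathbb{D}$ (data values) whose only predicate is equality, which is decidable. $\mathrm{Trc}=\mathbb{D}^\omega$ is the set of (infinite) traces, $\mathbb{D}^*$ the set of finite traces. **Logic.** Let $\mathrm{DVar}$ be a countably infinite set of data variables and $\star\notin\mathrm{DVar}$ a placeholder for the current data value. Constraint expressions: $b::=\mathsf{true}\mid e=f\mid\neg b\mid b\wedge b$ with $e,f\in\mathrm{DVar}\cup\{\star\}$. Formulae of $\mathrm{HML}^d$: $\varphi::=\mathsf{tt}\mid\mathsf{ff}\mid\langle b\rangle\varphi\mid[b]\varphi\mid\exists x.\varphi\mid\forall x.\varphi\mid\varphi\vee\varphi\mid\varphi\wedge\varphi$. For a data environment $\delta$ (partial function $\mathrm{DVar}\rightharpoonup\mathbb{D}$ with finite domain containing the free data variables of $\varphi$), $[\![\varphi,\delta]\!]\subseteq\mathrm{Trc}$ is given by: $[\![\mathsf{tt},\delta]\!]=\mathrm{Trc}$; $[\![\mathsf{ff},\delta]\!]=\varnothing$; $[\![\langle b\rangle\varphi,\delta]\!]=\{du\mid d\in\mathbb{D},\ b\text{ is true under }\delta[\star\mapsto d],\ u\in[\![\varphi,\delta]\!]\}$; $[\![[b]\varphi,\delta]\!]=\{du\mid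 \text{if }b\text{ is true under }\delta[\star\mapsto d]\text{ then }u\in[\![\varphi,\delta]\!]\}$; $[\![\exists x.\varphi,\delta]\!]=\bigcup_{d\in\mathbb{D}}[\![\varphi,\delta[x\mapsto d]]\!]$; $[\![\forall x.\varphi,\delta]\!]=\bigcap_{d\in\mathbb{D}}[\![\varphi,\delta[x\mapsto d]]\!]$; $\vee,\wedge$ are union and intersection. For closed $\varphi$ (no free data variable) the semantics does not depend on $\delta$ and is written $[\![\varphi]\!]$. **Monitors.** A monitor is an object $m$ (no computability requirement) with two predicates $\mathbf{acc}(m,w)$, $\mathbf{rej}(m,w)$ on finite traces $w\in\mathbb{D}^*$ such that (consistency) no $w$ satisfies both, and (irrevocability) if $w$ is a prefix of $w'$ then $\mathbf{acc}(m,w)\Rightarrow\mathbf{acc}(m,w')$ and $\mathbf{rej}(m,w)\Rightarrow\mathbf{rej}(m,w')$. For $t\in\mathrm{Trc}$, $\mathbf{acc}(m,t)$ (resp. $\mathbf{rej}(m,t)$) holds iff it holds for some finite prefix of $t$. $T\subseteq\mathrm{Trc}$ is completely monitorable if there is a monitor $m$ such that for all $t\in\mathrm{Trc}$: $t\in T\Rightarrow\mathbf{acc}(m,t)$ and $t\notin T\Rightarrow\mathbf{rej}(m,t)$. -}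

module Defs where

open import Data.Bool.Base using (if_then_else_)
open import Data.Empty using (⊥)
open import Data.List.Base using (List; []; _∷_; applyUpTo)
open import Data.List.Relation.Binary.Prefix.Heterogeneous using (Prefix)
open import Data.Maybe.Base using (Maybe; just; nothing)
open import Data.Nat.Base using (ℕ; zero; suc)
import Data.Nat.Properties as ℕ
open import Data.Product.Base using (Σ-syntax; ∃-syntax; _×_; _,_)
open import Data.Sum.Base using (_⊎_)
open import Data.Unit.Base using (⊤)
open import Function.Base using (_∘_)
open import Function.Bundles using (_↔_; Inverse)
open import Function.Properties.Inverse using (↔⇒↣)
open import Level using (0ℓ)
open import Relation.Binary.Definitions using (DecidableEquality)
open import Relation.Binary.PropositionalEquality using (_≡_; _≢_; _≗_)
open import Relation.Nullary.Decidable using (does; via-injection)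
open import Relation.Nullary.Negation.Core using (¬_)
open import Relation.Unary using (Pred; _∈_; _∉_; _≐_)

Trc : Set → Set
Trc 𝔻 = ℕ → 𝔻

module _ {𝔻 : Set} where

  head : Trc 𝔻 → 𝔻
  head t = t zero

  tail : Trc 𝔻 → Trc 𝔻
  tail t = t ∘ suc

  -- Equality of traces is pointwise, since there is no function
  -- extensionality.
  image : 𝔻 ↔ 𝔻 → Pred (Trc 𝔻) 0ℓ → Pred (Trc 𝔻) 0ℓ
  image σ T t = ∃[ s ] (s ∈ T × t ≗ (Inverse.to σ ∘ s))

  StableUnderRenaming : Pred (Trc 𝔻) 0ℓ → Set
  StableUnderRenaming T = (σ : 𝔻 ↔ 𝔻) → image σ T ≐ T

record Monitor (𝔻 : Set) : Set₁ where
  field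
    acc rej         : Pred (List 𝔻) 0ℓ
    consistent      : ∀ w → ¬ (acc w × rej w)
    acc-irrevocable : ∀ {w w′} → Prefix _≡_ w w′ → acc w → acc w′
    rej-irrevocable : ∀ {w w′} → Prefix _≡_ w w′ → rej w → rej w′

  -- applyUpTo t n is the prefix of t of length n.
  acc∞ rej∞ : Pred (Trc 𝔻) 0ℓ
  acc∞ t = ∃[ n ] acc (applyUpTo t n)
  rej∞ t = ∃[ n ] rej (applyUpTo t n)

CompletelyMonitorable : {𝔻 : Set} → Pred (Trc 𝔻) 0ℓ → Set₁
CompletelyMonitorable {𝔻} T =
  Σ[ m ∈ Monitor 𝔻 ] (∀ t → (t ∈ T → Monitor.acc∞ m t) ×
                            (t ∉ T → Monitor.rej∞ m t))

infix  9 _≈_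
infixr 8 _∧_
infixr 7 _∨_
infixr 9 ⟨_⟩_ [_]_

data Expr (DVar : Set) : Set where
  ⋆   : Expr DVar
  var : DVar → Expr DVar

data Constraint (DVar : Set) : Set where
  true : Constraint DVar
  _≈_  : Expr DVar → Expr DVar → Constraint DVar
  not  : Constraint DVar → Constraint DVar
  and  : Constraint DVar → Constraint DVar → Constraint DVar

data Formula (DVar : Set) : Set where
  tt ff         : Formula DVar
  ⟨_⟩_ [_]_     : Constraint DVar → Formula DVar → Formula DVar
  exists forAll : DVar → Formula DVar → Formula DVar
  _∨_ _∧_       : Formula DVar → Formula DVar → Formula DVar

module _ {DVar : Set} where

  _occursIn_ : DVar → Constraint DVar → Set
  x occursIn true      = ⊥
  x occursIn (e ≈ f)   = var x ≡ e ⊎ var x ≡ f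
  x occursIn (not b)   = x occursIn b
  x occursIn (and b c) = x occursIn b ⊎ x occursIn c

  _freeIn_ : DVar → Formula DVar → Set
  x freeIn tt           = ⊥
  x freeIn ff           = ⊥
  x freeIn (⟨ b ⟩ φ)    = x occursIn b ⊎ x freeIn φ
  x freeIn ([ b ] φ)    = x occursIn b ⊎ x freeIn φ
  x freeIn (exists y φ) = x ≢ y × x freeIn φ
  x freeIn (forAll y φ) = x ≢ y × x freeIn φ
  x freeIn (φ ∨ ψ)      = x freeIn φ ⊎ x freeIn ψ
  x freeIn (φ ∧ ψ)      = x freeIn φ ⊎ x freeIn ψ

  Closed : Formula DVar → Set
  Closed φ = ∀ x → ¬ (x freeIn φ)

module Semantics (𝔻 DVar : Set) (DVar↔ℕ : DVar ↔ ℕ) where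

  _≟_ : DecidableEquality DVar
  _≟_ = via-injection (↔⇒↣ DVar↔ℕ) ℕ._≟_

  -- Partial functions with finite domain, as association lists in which
  -- the leftmost binding of a variable is the valid one.
  Env : Set
  Env = List (DVar × 𝔻)

  _[_↦_] : Env → DVar → 𝔻 → Env
  δ [ x ↦ d ] = (x , d) ∷ δ

  lookup : Env → DVar → Maybe 𝔻
  lookup []            x = nothing
  lookup ((y , d) ∷ δ) x = if does (x ≟ y) then just d else lookup δ x

  -- The third argument is the value of ⋆.
  value : Expr DVar → Env → 𝔻 → Maybe 𝔻
  value ⋆       δ d = just d
  value (var x) δ d = lookup δ x

  -- A variable outside the domain of δ has no value, and an equation
  -- mentioning it does not hold.  This convention is immaterial: starting
  -- from a closed formula, every variable that is looked up is bound.
  Holds : Constraint DVar → Env → 𝔻 → Set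
  Holds true      δ d = ⊤
  Holds (e ≈ f)   δ d = ∃[ v ] (value e δ d ≡ just v × value f δ d ≡ just v)
  Holds (not b)   δ d = ¬ Holds b δ d
  Holds (and b c) δ d = Holds b δ d × Holds c δ d

  ⟦_⟧ : Formula DVar → Env → Pred (Trc 𝔻) 0ℓ
  ⟦ tt         ⟧ δ t = ⊤
  ⟦ ff         ⟧ δ t = ⊥
  ⟦ ⟨ b ⟩ φ    ⟧ δ t = Holds b δ (head t) × tail t ∈ ⟦ φ ⟧ δ
  ⟦ [ b ] φ    ⟧ δ t = Holds b δ (head t) → tail t ∈ ⟦ φ ⟧ δ
  ⟦ exists x φ ⟧ δ t = ∃[ d ] t ∈ ⟦ φ ⟧ (δ [ x ↦ d ])
  ⟦ forAll x φ ⟧ δ t = ∀ d → t ∈ ⟦ φ ⟧ (δ [ x ↦ d ])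
  ⟦ φ ∨ ψ      ⟧ δ t = t ∈ ⟦ φ ⟧ δ ⊎ t ∈ ⟦ ψ ⟧ δ
  ⟦ φ ∧ ψ      ⟧ δ t = t ∈ ⟦ φ ⟧ δ × t ∈ ⟦ ψ ⟧ δ

  -- Meaningful for closed formulae only: their semantics does not depend
  -- on the environment, and the empty one is a valid choice.
  ⟦_⟧∅ : Formula DVar → Pred (Trc 𝔻) 0ℓ
  ⟦ φ ⟧∅ = ⟦ φ ⟧ []

{-# OPTIONS --safe #-}

-- If the truth value of membership in T is settled after every trace has been
-- read for finitely many letters, a closed formula is found by bar induction.
-- Call a word v good when a formula over variables holding the letters of v
-- says of the remaining trace t that v t ∈ T, uniformly in all renamings of v.
-- A settled word is good, via tt or ff.  A word is good when all its one-letter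
-- extensions are: up to renaming there are only finitely many of them, namely
-- those by a letter of v and the one by a fresh letter, and a constraint tells
-- these apart.  So if the empty word were not good, there would be an infinite
-- trace all of whose prefixes are not good, hence never settled.
-- Conversely, a formula inspects only as many letters as its modal depth.

module Submission where

open import Defs
open import Axiom.ExcludedMiddle using (ExcludedMiddle)
open import Data.Empty using (⊥-elim)
open import Data.Fin.Base using (Fin; zero; suc)
open import Data.List.Base using (List; []; _∷_; _∷ʳ_; applyUpTo; length; allFin)
open import Data.List.Membership.Propositional using (lose)
open import Data.List.Membership.Propositional.Properties using (∈-allFin)
open import Data.List.Properties using (∷-injective; applyUpTo-∷ʳ; length-applyUpTo)
open import Data.List.Relation.Binary.Prefix.Heterogeneous using (Prefix; []; _∷_)
open import Data.List.Relation.Unary.Any as Any using (Any)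
open import Data.Maybe.Base using (just)
open import Data.Maybe.Properties using (just-injective)
open import Data.Nat.Base using (ℕ; zero; suc; _+_; _≤_; _<_; _⊔_; z≤n; s≤s; s≤s⁻¹)
open import Data.Nat.Properties
  using (≤-refl; ≤-total; ≤∧≢⇒<; <⇒≢; +-suc; m⊔n≤o⇒m≤o; m⊔n≤o⇒n≤o; m<n⇒m<1+n)
open import Data.Product.Base using (Σ-syntax; ∃-syntax; _×_; _,_; proj₁; proj₂)
open import Data.Sum.Base using (_⊎_; inj₁; inj₂; [_,_]′; map₁)
open import Data.Unit.Base using (tt)
open import Data.Vec.Base as Vec using (Vec; []; _∷_)
open import Function.Base using (_∘_)
open import Function.Bundles using (_↔_; _⇔_; Injection; Inverse; Equivalence; mk⇔; mk↔ₛ′)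
open import Function.Construct.Composition using (_↔-∘_)
open import Function.Construct.Identity using (↔-id)
open import Function.Construct.Symmetry using (↔-sym)
open import Function.Properties.Inverse using (↔⇒↣)
open import Level using (0ℓ)
open import Relation.Binary.PropositionalEquality
  using (_≡_; _≢_; _≗_; refl; sym; trans; cong; cong₂; subst; module ≡-Reasoning)
open import Relation.Nullary.Decidable
  using (Dec; yes; no; dec-true; dec-false; decidable-stable)
open import Relation.Nullary.Negation.Core using (¬_; contradiction)
open import Relation.Unary using (Pred; _∈_; _∉_; _≐_)

private variable
  𝔻 : Set
  k m n : ℕ

-- Traces with a word in front.

_◂_ : 𝔻 → Trc 𝔻 → Trc 𝔻
(d ◂ t) zero    = d
(d ◂ t) (suc n) = t n

◂-η : (t : Trc 𝔻) → head t ◂ tail t ≗ t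
◂-η t zero    = refl
◂-η t (suc n) = refl

-- The head of the vector is the letter read last.
prepend : Vec 𝔻 k → Trc 𝔻 → Trc 𝔻
prepend []      t = t
prepend (d ∷ v) t = prepend v (d ◂ t)

prepend-cong : (v : Vec 𝔻 k) {s t : Trc 𝔻} → s ≗ t → prepend v s ≗ prepend v t
prepend-cong []      s≗t = s≗t
prepend-cong (d ∷ v) s≗t = prepend-cong v λ where
  zero    → refl
  (suc n) → s≗t n

-- Used at `j = 0`, where `j + k` computes to `k`, the position right after the word.
prepend-+ : (v : Vec 𝔻 k) (t : Trc 𝔻) → ∀ j → prepend v t (j + k) ≡ t j
prepend-+ {k = zero}  []      t zero    = refl
prepend-+ {k = zero}  []      t (suc j) = prepend-+ [] (tail t) j
prepend-+ {k = suc k} (d ∷ v) t j       =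
  trans (cong (prepend v (d ◂ t)) (+-suc j k)) (prepend-+ v (d ◂ t) (suc j))

prepend-rename : (f : 𝔻 → 𝔻) (v w : Vec 𝔻 k) (t : Trc 𝔻) →
                 (∀ i → Vec.lookup w i ≡ f (Vec.lookup v i)) →
                 prepend w (f ∘ t) ≗ f ∘ prepend v t
prepend-rename f []      []      t w≡fv n = refl
prepend-rename f (c ∷ v) (d ∷ w) t w≡fv n = trans
  (prepend-cong w (λ { zero → w≡fv zero ; (suc _) → refl }) n)
  (prepend-rename f v w (c ◂ t) (w≡fv ∘ suc) n)

-- Finite prefixes and monitors.

applyUpTo-prefix : (t : Trc 𝔻) → m ≤ n → Prefix _≡_ (applyUpTo t m) (applyUpTo t n)
applyUpTo-prefix t z≤n       = []
applyUpTo-prefix t (s≤s m≤n) = refl ∷ applyUpTo-prefix (tail t) m≤n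

prefix-applyUpTo : {w w′ : List 𝔻} (t : Trc 𝔻) → Prefix _≡_ w w′ →
                   applyUpTo t (length w′) ≡ w′ → applyUpTo t (length w) ≡ w
prefix-applyUpTo t []         eq = refl
prefix-applyUpTo t (refl ∷ p) eq with refl , eq′ ← ∷-injective eq =
  cong (head t ∷_) (prefix-applyUpTo (tail t) p eq′)

extension : 𝔻 → (w : List 𝔻) → ∃[ t ] applyUpTo t (length w) ≡ w
extension d []      = (λ _ → d) , refl
extension d (c ∷ w) with t , eq ← extension d w = c ◂ t , cong (c ∷_) eq

-- Irrevocability carries both verdicts to the longer of the two prefixes, where consistency forbids
-- them.
acc∞-rej∞-exclusive : (M : Monitor 𝔻) (t : Trc 𝔻) →
                      ¬ (Monitor.acc∞ M t × Monitor.rej∞ M t)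
acc∞-rej∞-exclusive M t ((m , a) , (n , r)) with ≤-total m n
... | inj₁ m≤n = Monitor.consistent M _ (Monitor.acc-irrevocable M (applyUpTo-prefix t m≤n) a , r)
... | inj₂ n≤m = Monitor.consistent M _ (a , Monitor.rej-irrevocable M (applyUpTo-prefix t n≤m) r)

Determined : ℕ → Pred (Trc 𝔻) 0ℓ → Set
Determined n T = ∀ {s t} → applyUpTo s n ≡ applyUpTo t n → s ∈ T → t ∈ T

-- The monitor accepts a word when all its infinite extensions lie in `T` and rejects it when none
-- does. The given letter pads a word to a trace, so that the two verdicts exclude each other.
determined⇒monitorable : 𝔻 → {T : Pred (Trc 𝔻) 0ℓ} →
                         Determined n T → CompletelyMonitorable T
determined⇒monitorable {n = n} d {T} det = M , λ t →
  (λ t∈T → n , λ s eq → det (sym (cut t s eq)) t∈T) ,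
  (λ t∉T → n , λ s eq s∈T → t∉T (det (cut t s eq) s∈T))
  where
  M : Monitor _
  M = record
    { acc = λ w → ∀ t → applyUpTo t (length w) ≡ w → t ∈ T
    ; rej = λ w → ∀ t → applyUpTo t (length w) ≡ w → t ∉ T
    ; consistent = λ w (a , r) → let t , eq = extension d w in r t eq (a t eq)
    ; acc-irrevocable = λ p a t eq → a t (prefix-applyUpTo t p eq)
    ; rej-irrevocable = λ p r t eq → r t (prefix-applyUpTo t p eq)
    }

  cut : ∀ t s → applyUpTo s (length (applyUpTo t n)) ≡ applyUpTo t n →
        applyUpTo s n ≡ applyUpTo t n
  cut t s = subst (λ l → applyUpTo s l ≡ applyUpTo t n) (length-applyUpTo t n)

SettledAt : Pred (Trc 𝔻) 0ℓ → Trc 𝔻 → ℕ → Set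
SettledAt T t n =
  (∀ s → applyUpTo s n ≡ applyUpTo t n → s ∈ T) ⊎
  (∀ s → applyUpTo s n ≡ applyUpTo t n → s ∉ T)

-- The verdict on a prefix of `t` is also a verdict on every trace sharing that prefix. Such a trace
-- on the other side of `T` would receive both verdicts.
monitorable⇒settled : ExcludedMiddle 0ℓ → {T : Pred (Trc 𝔻) 0ℓ} →
                      CompletelyMonitorable T → ∀ t → ∃[ n ] SettledAt T t n
monitorable⇒settled em {T} (M , complete) t with em {P = t ∈ T}
... | yes t∈T = let n , a = proj₁ (complete t) t∈T in
  n , inj₁ λ s eq → decidable-stable em λ s∉T →
    acc∞-rej∞-exclusive M s ((n , subst (Monitor.acc M) (sym eq) a) , proj₂ (complete s) s∉T)
... | no  t∉T = let n , r = proj₂ (complete t) t∉T in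
  n , inj₂ λ s eq s∈T →
    acc∞-rej∞-exclusive M s (proj₁ (complete s) s∈T , (n , subst (Monitor.rej M) (sym eq) r))

-- Transpositions of data values.

module _ (_≟_ : (c d : 𝔻) → Dec (c ≡ d)) where

  swap : 𝔻 → 𝔻 → 𝔻 → 𝔻
  swap a b c with c ≟ a | c ≟ b
  ... | yes _ | _     = b
  ... | no _  | yes _ = a
  ... | no _  | no _  = c

  swap-left : ∀ a b → swap a b a ≡ b
  swap-left a b with a ≟ a | a ≟ b
  ... | yes _  | _ = refl
  ... | no a≢a | _ = contradiction refl a≢a

  swap-right : ∀ a b → swap a b b ≡ a
  swap-right a b with b ≟ a | b ≟ b
  ... | yes b≡a | _      = b≡a
  ... | no _    | yes _  = refl
  ... | no _    | no b≢b = contradiction refl b≢b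

  swap-other : ∀ {a b c} → c ≢ a → c ≢ b → swap a b c ≡ c
  swap-other {a} {b} {c} c≢a c≢b with c ≟ a | c ≟ b
  ... | yes c≡a | _       = contradiction c≡a c≢a
  ... | no _    | yes c≡b = contradiction c≡b c≢b
  ... | no _    | no _    = refl

  swap-involutive : ∀ a b c → swap a b (swap a b c) ≡ c
  swap-involutive a b c with c ≟ a | c ≟ b
  ... | yes refl | _        = swap-right a b
  ... | no _     | yes refl = swap-left a b
  ... | no c≢a   | no c≢b   = swap-other c≢a c≢b

  swap↔ : 𝔻 → 𝔻 → 𝔻 ↔ 𝔻
  swap↔ a b = mk↔ₛ′ (swap a b) (swap a b) (swap-involutive a b) (swap-involutive a b)

module _ (𝔻 DVar : Set) (DVar↔ℕ : DVar ↔ ℕ) where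
  open Semantics 𝔻 DVar DVar↔ℕ

  -- Modal depth of formulae.

  depth : Formula DVar → ℕ
  depth tt           = 0
  depth ff           = 0
  depth (⟨ b ⟩ φ)    = suc (depth φ)
  depth ([ b ] φ)    = suc (depth φ)
  depth (exists x φ) = depth φ
  depth (forAll x φ) = depth φ
  depth (φ ∨ ψ)      = depth φ ⊔ depth ψ
  depth (φ ∧ ψ)      = depth φ ⊔ depth ψ

  -- The bound is an inequality so that both operands of a connective can use the same `n`.
  depth-determines : ∀ φ δ → depth φ ≤ n → Determined n (⟦ φ ⟧ δ)
  depth-determines tt        δ _ eq s∈ = s∈
  depth-determines (⟨ b ⟩ φ) δ (s≤s φ≤n) eq (h , s∈) =
    let h≡ , tl≡ = ∷-injective eq in
    subst (Holds b δ) h≡ h , depth-determines φ δ φ≤n tl≡ s∈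
  depth-determines ([ b ] φ) δ (s≤s φ≤n) eq s∈ h =
    let h≡ , tl≡ = ∷-injective eq in
    depth-determines φ δ φ≤n tl≡ (s∈ (subst (Holds b δ) (sym h≡) h))
  depth-determines (exists x φ) δ φ≤n eq (d , s∈) = d , depth-determines φ _ φ≤n eq s∈
  depth-determines (forAll x φ) δ φ≤n eq s∈ d = depth-determines φ _ φ≤n eq (s∈ d)
  depth-determines (φ ∨ ψ) δ le eq (inj₁ s∈) =
    inj₁ (depth-determines φ δ (m⊔n≤o⇒m≤o (depth φ) _ le) eq s∈)
  depth-determines (φ ∨ ψ) δ le eq (inj₂ s∈) =
    inj₂ (depth-determines ψ δ (m⊔n≤o⇒n≤o (depth φ) _ le) eq s∈)
  depth-determines (φ ∧ ψ) δ le eq (s∈φ , s∈ψ) =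
    depth-determines φ δ (m⊔n≤o⇒m≤o (depth φ) _ le) eq s∈φ ,
    depth-determines ψ δ (m⊔n≤o⇒n≤o (depth φ) _ le) eq s∈ψ

  -- Variables as storage for letters.

  index : DVar → ℕ
  index = Inverse.to DVar↔ℕ

  x# : ℕ → DVar
  x# = Inverse.from DVar↔ℕ

  index-x# : ∀ n → index (x# n) ≡ n
  index-x# n = Inverse.inverseˡ DVar↔ℕ refl

  x#-index : ∀ x → x# (index x) ≡ x
  x#-index x = Inverse.inverseʳ DVar↔ℕ refl

  -- The variable x# n holds the letter at position n of the word; since
  -- vectors start with the letter read last, the indices descend.
  env : Vec 𝔻 k → Env
  env             []      = []
  env {k = suc k} (d ∷ v) = env v [ x# k ↦ d ]

  -- This is `k - 1 - i`. Counting from the oldest letter keeps the variable of a letter fixed while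
  -- the word grows.
  slot : Fin k → ℕ
  slot {suc k} zero    = k
  slot {suc k} (suc i) = slot i

  slot<k : (i : Fin k) → slot i < k
  slot<k {suc k} zero    = ≤-refl
  slot<k {suc k} (suc i) = m<n⇒m<1+n (slot<k i)

  lookup-env : (v : Vec 𝔻 k) (i : Fin k) → lookup (env v) (x# (slot i)) ≡ just (Vec.lookup v i)
  lookup-env {k = suc k} (d ∷ v) zero rewrite dec-true (x# k ≟ x# k) refl = refl
  lookup-env {k = suc k} (d ∷ v) (suc i)
    rewrite dec-false (x# (slot i) ≟ x# k)
      (λ eq → <⇒≢ (slot<k i) (trans (sym (index-x# _)) (trans (cong index eq) (index-x# k))))
    = lookup-env v i

  holds-≈ : (v : Vec 𝔻 k) (i : Fin k) {d : 𝔻} →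
            Holds (⋆ ≈ var (x# (slot i))) (env v) d ⇔ d ≡ Vec.lookup v i
  holds-≈ v i = mk⇔
    (λ (_ , d≡ , l≡) → just-injective (trans d≡ (trans (sym l≡) (lookup-env v i))))
    (λ { refl → _ , refl , lookup-env v i })

  Scoped : ℕ → Formula DVar → Set
  Scoped k φ = ∀ x → x freeIn φ → index x < k

  scoped-≈ : (i : Fin k) → ∀ x → x occursIn (⋆ ≈ var (x# (slot i))) → index x < k
  scoped-≈ {k} i x (inj₂ refl) = subst (_< k) (sym (index-x# (slot i))) (slot<k i)

  scoped-exists : ∀ {φ} → Scoped (suc k) φ → Scoped k (exists (x# k) φ)
  scoped-exists sc x (x≢ , x∈) = ≤∧≢⇒< (s≤s⁻¹ (sc x x∈))
    λ eq → x≢ (trans (sym (x#-index x)) (cong x# eq))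

  -- Words up to renaming and the formulae representing them.

  module _ (em : ExcludedMiddle 0ℓ)
           (T : Pred (Trc 𝔻) 0ℓ) (stable : StableUnderRenaming T) where

    T-rename : (σ : 𝔻 ↔ 𝔻) {s t : Trc 𝔻} → t ≗ Inverse.to σ ∘ s → s ∈ T → t ∈ T
    T-rename σ t≗σs s∈T = proj₁ (stable σ) (_ , s∈T , t≗σs)

    T-resp : {s t : Trc 𝔻} → s ≗ t → s ∈ T → t ∈ T
    T-resp s≗t = T-rename (↔-id 𝔻) (sym ∘ s≗t)

    -- The renaming permutes all of `𝔻`, not only the letters of `v`, so that stability of `T`
    -- applies to it.
    _∼_ : Vec 𝔻 k → Vec 𝔻 k → Set
    v ∼ w = Σ[ σ ∈ 𝔻 ↔ 𝔻 ] (∀ i → Vec.lookup w i ≡ Inverse.to σ (Vec.lookup v i))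

    ∼-preserves-T : (v w : Vec 𝔻 k) ((σ , _) : v ∼ w) (t : Trc 𝔻) →
                    prepend v (Inverse.from σ ∘ t) ∈ T ⇔ prepend w t ∈ T
    ∼-preserves-T v w (σ , w≡σv) t =
        mk⇔ (T-rename σ wt≗) (T-rename (↔-sym σ) λ n → sym (Inverse.inverseʳ σ (wt≗ n)))
      where
      wt≗ : prepend w t ≗ Inverse.to σ ∘ prepend v (Inverse.from σ ∘ t)
      wt≗ n = trans
        (prepend-cong w (λ _ → sym (Inverse.inverseˡ σ refl)) n)
        (prepend-rename (Inverse.to σ) v w (Inverse.from σ ∘ t) w≡σv n)

    Represents : Formula DVar → Vec 𝔻 k → Set
    Represents φ v = ∀ w → v ∼ w → ∀ t → t ∈ ⟦ φ ⟧ (env w) ⇔ prepend w t ∈ T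

    Good : Vec 𝔻 k → Set
    Good {k} v = ∃[ φ ] (Scoped k φ × Represents φ v)

    inside⇒good : (v : Vec 𝔻 k) → (∀ t → prepend v t ∈ T) → Good v
    inside⇒good v inside = tt , (λ _ ()) , λ w v∼w t →
      mk⇔ (λ _ → Equivalence.to (∼-preserves-T v w v∼w t) (inside _)) (λ _ → tt)

    outside⇒good : (v : Vec 𝔻 k) → (∀ t → prepend v t ∉ T) → Good v
    outside⇒good v outside = ff , (λ _ ()) , λ w v∼w t →
      mk⇔ (λ ()) (λ t∈ → outside _ (Equivalence.from (∼-preserves-T v w v∼w t) t∈))

    Fresh : 𝔻 → Vec 𝔻 k → Set
    Fresh d v = ∀ i → d ≢ Vec.lookup v i

    ∼-repeat : {v w : Vec 𝔻 k} (i : Fin k) → v ∼ w →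
               (Vec.lookup v i ∷ v) ∼ (Vec.lookup w i ∷ w)
    ∼-repeat i (σ , eq) = σ , λ { zero → eq i ; (suc j) → eq j }

    -- After `σ`, the transposition of `σ c` and `d` sends `c` to `d`. It fixes each letter of `w`,
    -- which differs from `σ c` by injectivity and from `d` by freshness.
    ∼-fresh : {v w : Vec 𝔻 k} {c d : 𝔻} → Fresh c v → Fresh d w → v ∼ w →
              (c ∷ v) ∼ (d ∷ w)
    ∼-fresh {v = v} {w} {c} {d} c∉v d∉w (σ , eq) = swap↔ ≟em σc d ↔-∘ σ , λ where
        zero    → sym (swap-left ≟em σc d)
        (suc i) → trans (eq i) (sym (swap-other ≟em
          (λ σvᵢ≡σc → c∉v i (sym (Injection.injective (↔⇒↣ σ) σvᵢ≡σc)))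
          (λ σvᵢ≡d → d∉w i (sym (trans (eq i) σvᵢ≡d)))))
      where
      σc = Inverse.to σ c
      ≟em : (a b : 𝔻) → Dec (a ≡ b)
      ≟em _ _ = em

    unfold-head : (w : Vec 𝔻 k) (t : Trc 𝔻) →
                  prepend (head t ∷ w) (tail t) ∈ T ⇔ prepend w t ∈ T
    unfold-head w t = mk⇔
      (T-resp (prepend-cong w (◂-η t))) (T-resp (prepend-cong w (sym ∘ ◂-η t)))

    Among : List (Fin k) → 𝔻 → Vec 𝔻 k → Set
    Among is d w = Any (λ i → d ≡ Vec.lookup w i) is

    -- The formula is evaluated with the head of t already stored in x# k, but
    -- before that letter is consumed.
    Distinguishes : Vec 𝔻 k → List (Fin k) → Formula DVar → Set
    Distinguishes v is ψ = ∀ w → v ∼ w → ∀ t →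
      Among is (head t) w ⊎ Fresh (head t) w →
      t ∈ ⟦ ψ ⟧ (env (head t ∷ w)) ⇔ prepend w t ∈ T

    -- From all one-letter extensions to the word itself.

    module _ (v : Vec 𝔻 k) (good : ∀ d → Good (d ∷ v)) where

      fresh-case : ∃[ ψ ] (Scoped (suc k) ψ × Distinguishes v [] ψ)
      fresh-case with em {P = ∃[ c ] Fresh c v}
      -- This cannot happen for infinite 𝔻, but ff is correct here in any case.
      ... | no ∄fresh = ff , (λ _ ()) , λ where
        w (σ , eq) t (inj₂ h∉w) → ⊥-elim (∄fresh (Inverse.from σ (head t) , λ i h≡ →
          h∉w i (trans (sym (Inverse.inverseˡ σ (sym h≡))) (sym (eq i)))))
      ... | yes (c , c∉v) with φ , sc , rep ← good c =
        -- Freshness of the head is assumed here, as the tests in `cases` have failed by then. By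
        -- `∼-fresh`, the formula for the single letter `c` serves every fresh head.
        ⟨ true ⟩ φ , (λ { x (inj₂ x∈) → sc x x∈ }) , λ where
          w v∼w t (inj₂ h∉w) →
            let open Equivalence (rep (head t ∷ w) (∼-fresh c∉v h∉w v∼w) (tail t))
                module U = Equivalence (unfold-head w t)
            in mk⇔ (λ (_ , t∈) → U.to (to t∈)) (λ t∈ → _ , from (U.from t∈))

      -- Induction on the positions still to be tested. A head that fails every test must be fresh.
      cases : ∀ is → ∃[ ψ ] (Scoped (suc k) ψ × Distinguishes v is ψ)
      cases []       = fresh-case
      cases (i ∷ is) with φ , scφ , rep ← good (Vec.lookup v i) | ψ , scψ , dist ← cases is =
        -- If-then-else on `b`. The conjunct `⟨ not b ⟩ tt` only peeks at the head, since `ψ` is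
        -- evaluated on the same trace.
        (⟨ b ⟩ φ) ∨ ((⟨ not b ⟩ tt) ∧ ψ) , sc , dist′
        where
        b = ⋆ ≈ var (x# (slot i))

        sc : Scoped (suc k) ((⟨ b ⟩ φ) ∨ ((⟨ not b ⟩ tt) ∧ ψ))
        sc x (inj₁ (inj₁ x∈))        = m<n⇒m<1+n (scoped-≈ i x x∈)
        sc x (inj₁ (inj₂ x∈))        = scφ x x∈
        sc x (inj₂ (inj₁ (inj₁ x∈))) = m<n⇒m<1+n (scoped-≈ i x x∈)
        sc x (inj₂ (inj₂ x∈))        = scψ x x∈

        dist′ : Distinguishes v (i ∷ is) ((⟨ b ⟩ φ) ∨ ((⟨ not b ⟩ tt) ∧ ψ))
        dist′ w v∼w t h∈ with em {P = head t ≡ Vec.lookup w i}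
        ... | yes h≡ = mk⇔
            (λ { (inj₁ (_ , t∈)) → U.to (R.to t∈)
               ; (inj₂ ((¬h , _) , _)) → contradiction (B.from h≡) ¬h })
            (λ t∈ → inj₁ (B.from h≡ , R.from (U.from t∈)))
          where
          module U = Equivalence (unfold-head w t)
          -- Storing the head shifts position `i` of `w` to `suc i`, with the same slot.
          module B = Equivalence (holds-≈ (head t ∷ w) (suc i) {head t})
          module R = Equivalence (rep (head t ∷ w)
            (subst (λ d → (Vec.lookup v i ∷ v) ∼ (d ∷ w)) (sym h≡) (∼-repeat i v∼w)) (tail t))
        ... | no  h≢ = mk⇔
            (λ { (inj₁ (h , _)) → contradiction (B.to h) h≢
               ; (inj₂ (_ , t∈)) → D.to t∈ })
            (λ t∈ → inj₂ ((h≢ ∘ B.to , _) , D.from t∈))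
          where
          module B = Equivalence (holds-≈ (head t ∷ w) (suc i) {head t})
          module D = Equivalence (dist w v∼w t (map₁ (Any.tail h≢) h∈))

      good-step : Good v
      good-step with ψ , sc , dist ← cases (allFin k) =
        -- The guard `⟨ b ⟩ tt` forces the quantified value to be the head, without consuming it.
        exists (x# k) ((⟨ b ⟩ tt) ∧ ψ) , scoped-exists {φ = (⟨ b ⟩ tt) ∧ ψ} sc′ , rep
        where
        b = ⋆ ≈ var (x# k)

        sc′ : Scoped (suc k) ((⟨ b ⟩ tt) ∧ ψ)
        sc′ x (inj₁ (inj₁ x∈)) = scoped-≈ {k = suc k} zero x x∈
        sc′ x (inj₂ x∈)        = sc x x∈

        rep : Represents (exists (x# k) ((⟨ b ⟩ tt) ∧ ψ)) v
        rep w v∼w t = mk⇔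
            (λ (d , (h , _) , t∈) → to (subst (λ e → t ∈ ⟦ ψ ⟧ (env (e ∷ w)))
              (sym (Equivalence.to (holds-≈ (d ∷ w) zero) h)) t∈))
            (λ t∈ → head t ,
              (Equivalence.from (holds-≈ (head t ∷ w) zero) refl , tt) , from t∈)
          where
          among : Among (allFin k) (head t) w ⊎ Fresh (head t) w
          among with em {P = ∃[ i ] head t ≡ Vec.lookup w i}
          ... | yes (i , h≡) = inj₁ (lose (∈-allFin i) h≡)
          ... | no  ∄i       = inj₂ λ i h≡ → ∄i (i , h≡)
          open Equivalence (dist w v∼w t among)

    -- Bar induction: a trace through bad words.

    bad-extension : (v : Vec 𝔻 k) → ¬ Good v → ∃[ d ] ¬ Good (d ∷ v)
    bad-extension v bad = decidable-stable em λ ∄d →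
      bad (good-step v λ d → decidable-stable em λ bad-d → ∄d (d , bad-d))

    module _ (bad : ¬ Good []) where

      badWord : ∀ n → ∃[ v ] ¬ Good {n} v
      badWord zero    = [] , bad
      badWord (suc n) = let v , bad-v = badWord n
                            d , bad-d = bad-extension v bad-v in d ∷ v , bad-d

      badTrace : Trc 𝔻
      badTrace n = Vec.head (proj₁ (badWord (suc n)))

      -- By definition `badWord (suc n)` has head `badTrace n` and tail `badWord n`, so the bad
      -- words are the prefixes of one trace.
      badTrace-prefix : ∀ n t →
        applyUpTo (prepend (proj₁ (badWord n)) t) n ≡ applyUpTo badTrace n
      badTrace-prefix zero    t = refl
      badTrace-prefix (suc n) t = begin
        applyUpTo s (suc n)                   ≡⟨ applyUpTo-∷ʳ s n ⟨
        applyUpTo s n ∷ʳ s n                  ≡⟨ cong₂ _∷ʳ_ (badTrace-prefix n _) (prepend-+ v _ 0) ⟩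
        applyUpTo badTrace n ∷ʳ badTrace n    ≡⟨ applyUpTo-∷ʳ badTrace n ⟩
        applyUpTo badTrace (suc n)            ∎
        where
        open ≡-Reasoning
        v = proj₁ (badWord n)
        s = prepend v (badTrace n ◂ t)

      badTrace-unsettled : ∀ n → ¬ SettledAt T badTrace n
      badTrace-unsettled n settled = proj₂ (badWord n)
        ([ (λ inside  → inside⇒good v λ t → inside _ (badTrace-prefix n t))
         , (λ outside → outside⇒good v λ t → outside _ (badTrace-prefix n t)) ]′ settled)
        where v = proj₁ (badWord n)

    settled⇒good-[] : (∀ t → ∃[ n ] SettledAt T t n) → Good []
    settled⇒good-[] settled = decidable-stable em λ bad →
      let n , settled-n = settled (badTrace bad) in badTrace-unsettled bad n settled-n

    good-[]⇒definable : Good [] → ∃[ φ ] (Closed φ × ⟦ φ ⟧∅ ≐ T)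
    good-[]⇒definable (φ , sc , rep) =
      φ , (λ x x∈ → contradiction (sc x x∈) λ ()) ,
      (λ {t} → Equivalence.to (rep [] ∼-[] t)) , (λ {t} → Equivalence.from (rep [] ∼-[] t))
      where
      ∼-[] : [] ∼ []
      ∼-[] = ↔-id 𝔻 , λ ()

theorem13 : ExcludedMiddle 0ℓ →
    (𝔻 DVar : Set) (𝔻↔ℕ : 𝔻 ↔ ℕ) (DVar↔ℕ : DVar ↔ ℕ) →
    let open Semantics 𝔻 DVar DVar↔ℕ in
    (T : Pred (Trc 𝔻) 0ℓ) → StableUnderRenaming T →
    CompletelyMonitorable T ⇔ (∃[ φ ] (Closed φ × ⟦ φ ⟧∅ ≐ T))
theorem13 em 𝔻 DVar 𝔻↔ℕ DVar↔ℕ T stable = mk⇔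
  (λ monitorable → good-[]⇒definable 𝔻 DVar DVar↔ℕ em T stable
    (settled⇒good-[] 𝔻 DVar DVar↔ℕ em T stable (monitorable⇒settled em monitorable)))
  (λ (φ , _ , φ⊆T , T⊆φ) → determined⇒monitorable (Inverse.from 𝔻↔ℕ 0)
    λ eq s∈T → φ⊆T (depth-determines 𝔻 DVar DVar↔ℕ φ [] ≤-refl eq (T⊆φ s∈T)))
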